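{- (1) If $\ell\mathsf{IKt}2\vdash A$ then $\mathsf{IKt}2\vdash A$. (2) If $\ell\mathsf{Kt}2\vdash A$ then $\mathsf{Kt}2\vdash A$.
   Context: Formulas: $A ::= P \mid X \mid A\to B \mid \Box A \mid \blacksquare A \mid \forall X A$, with $\bot := \forall XX$, $\neg A := A\to\bot$, $\Diamond A := \forall X(\Box(A\to\blacksquare X)\to X)$, backward diamond $\Diamond^{\bullet}A := \forall X(\blacksquare(A\to\Box X)\to X)$. $\mathsf{IKt}2$: second-order intuitionistic propositional logic (with full comprehension $\forall XA\to A[C/X]$, modus ponens, generalisation with fresh propositional symbol), distribution axioms $\Box(A\to B)\to\Box A\to\Box B$, $\Box(A\to B)\to\Diamond A\to\Diamond B$, $\blacksquare(A\to B)\to\blacksquare A\to\blacksquare B$, $\blacksquare(A\to B)\to\Diamond^{\bullet}A\to\Diamond^{\bullet}B$, necessitation for $\Box$ and $\blacksquare$, tense axioms $\Diamond^{\bullet}\Box A\to A$, $A\to\Box\Diamond^{\bullet}A$, $\Diamond\blacksquare A\to A$, $A\to\blacksquare\Diamond A$; $\mathsf{Kt}2 := \mathsf{IKt}2+(\neg\neg A\to A)$. Labelled sequents have the form $\mathcal{R}\mid\Gamma\Rightarrow\Delta$ with $\mathcal{R}$ a set of relational atoms $vRw$ between world labels and $\Gamma,\Delta$ multisets of labelled formulas $v:A$. $\ell\mathsf{Kt}2$ has rules: identity $\mathcal{R}\mid v:A\Rightarrow v:A$; cut; left/right weakening and contraction; $\to$-left (from $\mathcal{R}\mid\Gamma\Rightarrow\Delta,v:A$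 and $\mathcal{R}\mid\Gamma',v:B\Rightarrow\Delta'$ infer $\mathcal{R}\mid\Gamma,\Gamma',v:A\to B\Rightarrow\Delta,\Delta'$); $\to$-right (from $\mathcal{R}\mid\Gamma,v:A\Rightarrow\Delta,v:B$ infer $\mathcal{R}\mid\Gamma\Rightarrow\Delta,v:A\to B$); $\forall$-left (from $v:A[C/X]$ on the left, any formula $C$, infer $v:\forall XA$ on the left); $\forall$-right (from $v:A[P/X]$ on the right, $P$ fresh, infer $v:\forall XA$); $\Box$-left (with $vRw\in\mathcal{R}$, from $w:A$ on the left infer $v:\Box A$ on the left); $\Box$-right (from $\mathcal{R},vRw\mid\Gamma\Rightarrow\Delta,w:A$ with $w$ fresh infer $\mathcal{R}\mid\Gamma\Rightarrow\Delta,v:\Box A$); $\blacksquare$-left (with $uRv\in\mathcal{R}$, from $u:A$ on the left infer $v:\blacksquare A$ on the left); $\blacksquare$-right (from $\mathcal{R},uRv\mid\Gamma\Rightarrow\Delta,u:A$ with $u$ fresh infer $\mathcal{R}\mid\Gamma\Rightarrow\Delta,v:\blacksquare A$). $\ell\mathsf{IKt}2$ is the restriction of $\ell\mathsf{Kt}2$ to sequents with exactly one labelled formula on the right. $\mathsf{L}\vdash A$ means $\mathsf{L}$ proves $\emptyset\mid\emptyset\Rightarrow v:A$. -}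

module Defs where

open import Data.Nat using (ℕ; zero; suc)
open import Data.List using (List; []; _∷_; _++_; map; concatMap; length)
open import Data.List.Membership.Propositional using (_∈_; _∉_)
open import Data.List.Relation.Binary.Permutation.Propositional using (_↭_)
open import Data.Product using (_×_; _,_; proj₁; proj₂)
open import Data.Unit using (⊤)
open import Relation.Binary.PropositionalEquality using (_≡_)

-- Formulas: A ::= P | X | A → B | □A | ■A | ∀X A
-- Propositional symbols P are `atom n`; propositional variables X are
-- de Bruijn indices `var i` (bound by ∀').

infixr 5 _⇒_

data Form : Set where
  atom : ℕ → Form
  var  : ℕ → Form
  _⇒_  : Form → Form → Form
  □    : Form → Form
  ■    : Form → Form
  ∀'   : Form → Form

ext : (ℕ → ℕ) → ℕ → ℕ
ext ρ zero    = zero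
ext ρ (suc i) = suc (ρ i)

ren : (ℕ → ℕ) → Form → Form
ren ρ (atom p) = atom p
ren ρ (var i)  = var (ρ i)
ren ρ (A ⇒ B)  = ren ρ A ⇒ ren ρ B
ren ρ (□ A)    = □ (ren ρ A)
ren ρ (■ A)    = ■ (ren ρ A)
ren ρ (∀' A)   = ∀' (ren (ext ρ) A)

shift : Form → Form
shift = ren suc

exts : (ℕ → Form) → ℕ → Form
exts σ zero    = var zero
exts σ (suc i) = shift (σ i)

sub : (ℕ → Form) → Form → Form
sub σ (atom p) = atom p
sub σ (var i)  = σ i
sub σ (A ⇒ B)  = sub σ A ⇒ sub σ B
sub σ (□ A)    = □ (sub σ A)
sub σ (■ A)    = ■ (sub σ A)
sub σ (∀' A)   = ∀' (sub (exts σ) A)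

_[_] : Form → Form → Form
A [ C ] = sub σ A
  where
  σ : ℕ → Form
  σ zero    = C
  σ (suc i) = var i

atoms : Form → List ℕ
atoms (atom p) = p ∷ []
atoms (var i)  = []
atoms (A ⇒ B)  = atoms A ++ atoms B
atoms (□ A)    = atoms A
atoms (■ A)    = atoms A
atoms (∀' A)   = atoms A

⊥' : Form
⊥' = ∀' (var zero)

¬' : Form → Form
¬' A = A ⇒ ⊥'

◇ : Form → Form
◇ A = ∀' (□ (shift A ⇒ ■ (var zero)) ⇒ var zero)

◆ : Form → Form
◆ A = ∀' (■ (shift A ⇒ □ (var zero)) ⇒ var zero)

data Variant : Set where
  intu clas : Variant

data Hilbert (m : Variant) : Form → Set where
  ax-K   : ∀ A B → Hilbert m (A ⇒ B ⇒ A)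
  ax-S   : ∀ A B C → Hilbert m ((A ⇒ B ⇒ C) ⇒ (A ⇒ B) ⇒ A ⇒ C)
  ax-∀E  : ∀ A C → Hilbert m (∀' A ⇒ A [ C ])
  ax-∀I  : ∀ A B → Hilbert m (∀' (shift B ⇒ A) ⇒ B ⇒ ∀' A)
  mp     : ∀ {A B} → Hilbert m (A ⇒ B) → Hilbert m A → Hilbert m B
  gen    : ∀ A P → P ∉ atoms A → Hilbert m (A [ atom P ]) → Hilbert m (∀' A)
  ax-K□  : ∀ A B → Hilbert m (□ (A ⇒ B) ⇒ □ A ⇒ □ B)
  ax-K◇  : ∀ A B → Hilbert m (□ (A ⇒ B) ⇒ ◇ A ⇒ ◇ B)
  ax-K■  : ∀ A B → Hilbert m (■ (A ⇒ B) ⇒ ■ A ⇒ ■ B)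
  ax-K◆  : ∀ A B → Hilbert m (■ (A ⇒ B) ⇒ ◆ A ⇒ ◆ B)
  nec□   : ∀ {A} → Hilbert m A → Hilbert m (□ A)
  nec■   : ∀ {A} → Hilbert m A → Hilbert m (■ A)
  ax-t1  : ∀ A → Hilbert m (◆ (□ A) ⇒ A)
  ax-t2  : ∀ A → Hilbert m (A ⇒ □ (◆ A))
  ax-t3  : ∀ A → Hilbert m (◇ (■ A) ⇒ A)
  ax-t4  : ∀ A → Hilbert m (A ⇒ ■ (◇ A))
  ax-dne : m ≡ clas → ∀ A → Hilbert m (¬' (¬' A) ⇒ A)

IKt2⊢ : Form → Set
IKt2⊢ = Hilbert intu

Kt2⊢ : Form → Set
Kt2⊢ = Hilbert clas

Label : Set
Label = ℕ

LForm : Set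
LForm = Label × Form

RelSet : Set
RelSet = List (Label × Label)   -- set of relational atoms vRw, (v , w)

Good : Variant → List LForm → Set
Good intu Δ = length Δ ≡ 1
Good clas Δ = ⊤

SameSet : RelSet → RelSet → Set
SameSet R R' = (∀ x → x ∈ R → x ∈ R') × (∀ x → x ∈ R' → x ∈ R)

labelsR : RelSet → List Label
labelsR = concatMap (λ { (u , w) → u ∷ w ∷ [] })

labelsSeq : RelSet → List LForm → List LForm → List Label
labelsSeq R Γ Δ = labelsR R ++ map proj₁ Γ ++ map proj₁ Δ

atomsSeq : List LForm → List LForm → List ℕ
atomsSeq Γ Δ = concatMap (λ x → atoms (proj₂ x)) (Γ ++ Δ)

-- Derivability in ℓIKt2 (intu) / ℓKt2 (clas).  Multisets are lists up to
-- permutation (exchange rules), R is a set (SameSet rule).  Every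
-- conclusion carries the side condition `Good m Δ`, so in the intu case every
-- sequent in a derivation has exactly one formula on the right.
data LK (m : Variant) : RelSet → List LForm → List LForm → Set where
  idr   : ∀ {R v A} → Good m ((v , A) ∷ []) →
          LK m R ((v , A) ∷ []) ((v , A) ∷ [])
  cut   : ∀ {R Γ Γ' Δ Δ' v A} → Good m (Δ ++ Δ') →
          LK m R Γ ((v , A) ∷ Δ) → LK m R ((v , A) ∷ Γ') Δ' →
          LK m R (Γ ++ Γ') (Δ ++ Δ')
  exL   : ∀ {R Γ Γ' Δ} → Good m Δ → Γ ↭ Γ' → LK m R Γ Δ → LK m R Γ' Δ
  exR   : ∀ {R Γ Δ Δ'} → Good m Δ' → Δ ↭ Δ' → LK m R Γ Δ → LK m R Γ Δ'
  setR  : ∀ {R R' Γ Δ} → Good m Δ → SameSet R R' → LK m R Γ Δ → LK m R' Γ Δ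
  wL    : ∀ {R Γ Δ x} → Good m Δ → LK m R Γ Δ → LK m R (x ∷ Γ) Δ
  wR    : ∀ {R Γ Δ x} → Good m (x ∷ Δ) → LK m R Γ Δ → LK m R Γ (x ∷ Δ)
  cL    : ∀ {R Γ Δ x} → Good m Δ → LK m R (x ∷ x ∷ Γ) Δ → LK m R (x ∷ Γ) Δ
  cR    : ∀ {R Γ Δ x} → Good m (x ∷ Δ) → LK m R Γ (x ∷ x ∷ Δ) → LK m R Γ (x ∷ Δ)
  ⇒L    : ∀ {R Γ Γ' Δ Δ' v A B} → Good m (Δ ++ Δ') →
          LK m R Γ ((v , A) ∷ Δ) → LK m R ((v , B) ∷ Γ') Δ' →
          LK m R ((v , A ⇒ B) ∷ Γ ++ Γ') (Δ ++ Δ')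
  ⇒R    : ∀ {R Γ Δ v A B} → Good m ((v , A ⇒ B) ∷ Δ) →
          LK m R ((v , A) ∷ Γ) ((v , B) ∷ Δ) →
          LK m R Γ ((v , A ⇒ B) ∷ Δ)
  ∀L    : ∀ {R Γ Δ v A} (C : Form) → Good m Δ →
          LK m R ((v , A [ C ]) ∷ Γ) Δ → LK m R ((v , ∀' A) ∷ Γ) Δ
  ∀R    : ∀ {R Γ Δ v A} (P : ℕ) → Good m ((v , ∀' A) ∷ Δ) →
          P ∉ atomsSeq Γ ((v , ∀' A) ∷ Δ) →
          LK m R Γ ((v , A [ atom P ]) ∷ Δ) → LK m R Γ ((v , ∀' A) ∷ Δ)
  □L    : ∀ {R Γ Δ v w A} → Good m Δ → (v , w) ∈ R →
          LK m R ((w , A) ∷ Γ) Δ → LK m R ((v , □ A) ∷ Γ) Δ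
  □R    : ∀ {R Γ Δ v A} (w : Label) → Good m ((v , □ A) ∷ Δ) →
          w ∉ (v ∷ labelsSeq R Γ Δ) →
          LK m ((v , w) ∷ R) Γ ((w , A) ∷ Δ) → LK m R Γ ((v , □ A) ∷ Δ)
  ■L    : ∀ {R Γ Δ u v A} → Good m Δ → (u , v) ∈ R →
          LK m R ((u , A) ∷ Γ) Δ → LK m R ((v , ■ A) ∷ Γ) Δ
  ■R    : ∀ {R Γ Δ v A} (u : Label) → Good m ((v , ■ A) ∷ Δ) →
          u ∉ (v ∷ labelsSeq R Γ Δ) →
          LK m ((u , v) ∷ R) Γ ((u , A) ∷ Δ) → LK m R Γ ((v , ■ A) ∷ Δ)

ℓIKt2⊢ : Label → Form → Set
ℓIKt2⊢ v A = LK intu [] [] ((v , A) ∷ [])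

ℓKt2⊢ : Label → Form → Set
ℓKt2⊢ v A = LK clas [] [] ((v , A) ∷ [])

{-# OPTIONS --safe #-}

-- A birelational model whose worlds are formulas is used to read labelled sequents.  X ⊢ A stands for
-- provability of X ⇒ A, and X sees Y when Y ⊢ ◆ X and X ⊢ ◇ Y.  An intuitionistic sequent R ∣ Γ ⇒ v : A
-- is read as: every assignment ρ of worlds to labels that respects R and forces Γ has ρ v ⊢ A.  A
-- classical sequent R ∣ Γ ⇒ Δ is read as: every ρ that respects R, forces Γ and refutes Δ has ρ x ⊢ ⊥ for
-- some label x.  The right rules need ρ to be strengthened at one label and the change to be propagated
-- along R.  This is impossible for arbitrary R, but R grows only by edges to fresh labels when a derivation
-- with R = ∅ at its root is read upwards, and strengthenability survives the addition of such edges.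
-- Everything is quantified over renamings of atoms, so that the eigenvariable P of the ∀-right rule can be
-- replaced by an atom that does not occur in the world ρ v.
module Submission where

open import Defs
open import Data.List using (List; []; _∷_; _++_; map)
open import Data.List.Extrema.Nat using (max; xs≤max)
open import Data.List.Membership.Propositional using (_∈_; _∉_; lose)
open import Data.List.Membership.Propositional.Properties using (∈-++⁺ˡ; ∈-++⁺ʳ; ∈-concatMap⁺; ∈-map⁺)
open import Data.List.Relation.Binary.Permutation.Propositional using (↭-sym)
open import Data.List.Relation.Binary.Permutation.Propositional.Properties using (All-resp-↭)
open import Data.List.Relation.Unary.All as All using (All; []; _∷_)
open import Data.List.Relation.Unary.All.Properties using (++⁻ˡ; ++⁻ʳ)
open import Data.List.Relation.Unary.Any using (here; there)
open import Data.Nat using (ℕ; zero; suc; _≟_)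
open import Data.Nat.Properties using (1+n≰n)
open import Data.Product using (_×_; _,_; proj₁; proj₂; ∃-syntax)
open import Data.Sum as Sum using (_⊎_; inj₁; inj₂; [_,_]′)
open import Function using (_∘_; id)
open import Relation.Binary.PropositionalEquality using (_≡_; _≢_; refl; sym; trans; cong; cong₂; subst)
open import Relation.Nullary using (yes; no; contradiction)

-- Fresh atoms and function updates

fresh : List ℕ → ℕ
fresh ps = suc (max 0 ps)

fresh-∉ : ∀ ps → fresh ps ∉ ps
fresh-∉ ps p∈ = 1+n≰n (All.lookup (xs≤max 0 ps) p∈)

infix 9 _[_↦_]

_[_↦_] : ∀ {B : Set} → (ℕ → B) → ℕ → B → ℕ → B
(f [ n ↦ b ]) k with k ≟ n
... | yes _ = b
... | no  _ = f k

update-same : ∀ {B : Set} (f : ℕ → B) n b → (f [ n ↦ b ]) n ≡ b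
update-same f n b with n ≟ n
... | yes _  = refl
... | no n≢n = contradiction refl n≢n

update-other : ∀ {B : Set} (f : ℕ → B) {n k} b → k ≢ n → (f [ n ↦ b ]) k ≡ f k
update-other f {n} {k} b k≢n with k ≟ n
... | yes k≡n = contradiction k≡n k≢n
... | no  _   = refl

-- Substitution and renaming of atoms

rename : (ℕ → ℕ) → Form → Form
rename θ (atom p) = atom (θ p)
rename θ (var i)  = var i
rename θ (A ⇒ B)  = rename θ A ⇒ rename θ B
rename θ (□ A)    = □ (rename θ A)
rename θ (■ A)    = ■ (rename θ A)
rename θ (∀' A)   = ∀' (rename θ A)

rename-ren : ∀ θ {ρ} A → rename θ (ren ρ A) ≡ ren ρ (rename θ A)
rename-ren θ (atom p) = refl
rename-ren θ (var i)  = refl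
rename-ren θ (A ⇒ B)  = cong₂ _⇒_ (rename-ren θ A) (rename-ren θ B)
rename-ren θ (□ A)    = cong □ (rename-ren θ A)
rename-ren θ (■ A)    = cong ■ (rename-ren θ A)
rename-ren θ (∀' A)   = cong ∀' (rename-ren θ A)

rename-sub : ∀ θ {σ τ} A → (∀ i → rename θ (σ i) ≡ τ i) → rename θ (sub σ A) ≡ sub τ (rename θ A)
rename-sub θ (atom p) h = refl
rename-sub θ (var i)  h = h i
rename-sub θ (A ⇒ B)  h = cong₂ _⇒_ (rename-sub θ A h) (rename-sub θ B h)
rename-sub θ (□ A)    h = cong □ (rename-sub θ A h)
rename-sub θ (■ A)    h = cong ■ (rename-sub θ A h)
rename-sub θ (∀' A)   h = cong ∀' (rename-sub θ A λ where
  zero    → refl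
  (suc i) → trans (rename-ren θ _) (cong shift (h i)))

rename-[] : ∀ θ A C → rename θ (A [ C ]) ≡ rename θ A [ rename θ C ]
rename-[] θ A C = rename-sub θ A λ where
  zero    → refl
  (suc i) → refl

rename-cong : ∀ {θ θ'} A → (∀ {p} → p ∈ atoms A → θ p ≡ θ' p) → rename θ A ≡ rename θ' A
rename-cong (atom p) h = cong atom (h (here refl))
rename-cong (var i)  h = refl
rename-cong (A ⇒ B)  h = cong₂ _⇒_ (rename-cong A (h ∘ ∈-++⁺ˡ)) (rename-cong B (h ∘ ∈-++⁺ʳ (atoms A)))
rename-cong (□ A)    h = cong □ (rename-cong A h)
rename-cong (■ A)    h = cong ■ (rename-cong A h)
rename-cong (∀' A)   h = cong ∀' (rename-cong A h)

rename-id : ∀ A → rename id A ≡ A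
rename-id (atom p) = refl
rename-id (var i)  = refl
rename-id (A ⇒ B)  = cong₂ _⇒_ (rename-id A) (rename-id B)
rename-id (□ A)    = cong □ (rename-id A)
rename-id (■ A)    = cong ■ (rename-id A)
rename-id (∀' A)   = cong ∀' (rename-id A)

rename-update : ∀ θ {P} Q A → P ∉ atoms A → rename (θ [ P ↦ Q ]) A ≡ rename θ A
rename-update θ Q A P∉ = rename-cong A λ p∈ → update-other θ Q λ { refl → P∉ p∈ }

rename-update-[] : ∀ θ {P} Q A → P ∉ atoms A →
                   rename (θ [ P ↦ Q ]) (A [ atom P ]) ≡ rename θ A [ atom Q ]
rename-update-[] θ {P} Q A P∉ = trans (rename-[] (θ [ P ↦ Q ]) A (atom P))
  (cong₂ _[_] (rename-update θ Q A P∉) (cong atom (update-same θ P Q)))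

sub-ren : ∀ {σ ρ} A → (∀ i → σ (ρ i) ≡ var i) → sub σ (ren ρ A) ≡ A
sub-ren (atom p) h = refl
sub-ren (var i)  h = h i
sub-ren (A ⇒ B)  h = cong₂ _⇒_ (sub-ren A h) (sub-ren B h)
sub-ren (□ A)    h = cong □ (sub-ren A h)
sub-ren (■ A)    h = cong ■ (sub-ren A h)
sub-ren (∀' A)   h = cong ∀' (sub-ren A λ where
  zero    → refl
  (suc i) → cong shift (h i))

-- Encoded conjunction and the two directions of the modalities

infixr 6 _∧_

-- The impredicative conjunction, by which worlds are strengthened.
_∧_ : Form → Form → Form
A ∧ B = ∀' ((shift A ⇒ shift B ⇒ var 0) ⇒ var 0)

∧-[] : ∀ A B C → ((shift A ⇒ shift B ⇒ var 0) ⇒ var 0) [ C ] ≡ ((A ⇒ B ⇒ C) ⇒ C)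
∧-[] A B C = cong₂ (λ A' B' → (A' ⇒ B' ⇒ C) ⇒ C) (sub-ren A λ _ → refl) (sub-ren B λ _ → refl)

-- With the direction as a parameter, both tense adjunctions, `◆` left adjoint to `□` and `◇` left
-- adjoint to `■`, are handled by one proof.
data Dir : Set where
  fwd bwd : Dir

op : Dir → Dir
op fwd = bwd
op bwd = fwd

box dia : Dir → Form → Form
box fwd = □
box bwd = ■
dia fwd = ◇
dia bwd = ◆

edge : Dir → Label → Label → Label × Label
edge fwd v w = v , w
edge bwd v w = w , v

rename-box : ∀ θ d A → rename θ (box d A) ≡ box d (rename θ A)
rename-box θ fwd A = refl
rename-box θ bwd A = refl

-- Consequences of the side conditions of sequent rules

∉-labelsR : ∀ {x y w} R → (x , y) ∈ R → w ∉ labelsR R → x ≢ w × y ≢ w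
∉-labelsR R xy∈ w∉ =
    (λ { refl → w∉ (∈-concatMap⁺ _ (lose xy∈ (here refl))) })
  , (λ { refl → w∉ (∈-concatMap⁺ _ (lose xy∈ (there (here refl)))) })

∉-atomsSeq : ∀ {P x} Γ Δ → x ∈ Γ ++ Δ → P ∉ atomsSeq Γ Δ → P ∉ atoms (proj₂ x)
∉-atomsSeq Γ Δ x∈ P∉ P∈ = P∉ (∈-concatMap⁺ _ (lose x∈ P∈))

∉-map₁ : ∀ {w} {Γ : List LForm} {x} → w ∉ map proj₁ Γ → x ∈ Γ → proj₁ x ≢ w
∉-map₁ w∉ x∈ refl = w∉ (∈-map⁺ proj₁ x∈)

-- Applied to premises with `m = intu`, this excludes a nonempty `Δ` in `cut` and `⇒L` and an empty
-- one in `wR`.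
LK-good : ∀ {m R Γ Δ} → LK m R Γ Δ → Good m Δ
LK-good (idr g)        = g
LK-good (cut g _ _)    = g
LK-good (exL g _ _)    = g
LK-good (exR g _ _)    = g
LK-good (setR g _ _)   = g
LK-good (wL g _)       = g
LK-good (wR g _)       = g
LK-good (cL g _)       = g
LK-good (cR g _)       = g
LK-good (⇒L g _ _)     = g
LK-good (⇒R g _)       = g
LK-good (∀L _ g _)     = g
LK-good (∀R _ g _ _)   = g
LK-good (□L g _ _)     = g
LK-good (□R _ g _ _)   = g
LK-good (■L g _ _)     = g
LK-good (■R _ g _ _)   = g

module _ {m : Variant} where

  infix 4 _⊢_

  _⊢_ : Form → Form → Set
  X ⊢ A = Hilbert m (X ⇒ A)

  -- Derived rules of the Hilbert calculus

  weaken : ∀ {X A} → Hilbert m A → X ⊢ A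
  weaken p = mp (ax-K _ _) p

  ap : ∀ {X A B} → X ⊢ A ⇒ B → X ⊢ A → X ⊢ B
  ap f a = mp (mp (ax-S _ _ _) f) a

  ⊢-refl : ∀ {X} → X ⊢ X
  ⊢-refl {X} = ap (ax-K X (X ⇒ X)) (ax-K X X)

  ⊢-trans : ∀ {X Y Z} → X ⊢ Y → Y ⊢ Z → X ⊢ Z
  ⊢-trans f g = ap (weaken g) f

  ap₂ : ∀ {X Y A B} → X ⊢ Y ⇒ A ⇒ B → X ⊢ Y ⇒ A → X ⊢ Y ⇒ B
  ap₂ f a = ap (⊢-trans f (ax-S _ _ _)) a

  flip : ∀ {X Y A} → X ⊢ Y ⇒ A → Y ⊢ X ⇒ A
  flip f = ⊢-trans (ax-K _ _) (mp (ax-S _ _ _) f)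

  ⊢⊥-elim : ∀ {X A} → X ⊢ ⊥' → X ⊢ A
  ⊢⊥-elim f = ⊢-trans f (ax-∀E (var 0) _)

  -- `gen` is applied while `X` is still under the quantifier, so its atom must avoid `X` as well as
  -- `A`; `ax-∀I` then moves `X` out.
  ∀-intro : ∀ X A → X ⊢ A [ atom (fresh (atoms (shift X ⇒ A))) ] → X ⊢ ∀' A
  ∀-intro X A f = mp (ax-∀I A X) (gen (shift X ⇒ A) Q (fresh-∉ (atoms (shift X ⇒ A)))
    (subst (λ X' → X' ⊢ A [ atom Q ]) (sym (sub-ren X λ _ → refl)) f))
    where Q = fresh (atoms (shift X ⇒ A))

  pair : ∀ {A B} → A ⊢ B ⇒ A ∧ B
  pair {A} {B} = ⊢-trans (∀-intro A _ (subst (A ⊢_) (sym eq) body)) (ax-∀I _ B)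
    where
    Q = atom (fresh (atoms (shift A ⇒ shift B ⇒ (shift A ⇒ shift B ⇒ var 0) ⇒ var 0)))
    eq = cong₂ _⇒_ (sub-ren B λ _ → refl) (∧-[] A B Q)
    body : A ⊢ B ⇒ (A ⇒ B ⇒ Q) ⇒ Q
    body = ⊢-trans (flip ⊢-refl) (ap₂ (⊢-trans (ax-S _ _ _) (ax-K _ _)) (weaken (ax-K _ _)))

  ∧-elim : ∀ {A B} C → A ∧ B ⊢ (A ⇒ B ⇒ C) ⇒ C
  ∧-elim {A} {B} C = subst (A ∧ B ⊢_) (∧-[] A B C) (ax-∀E _ C)

  ∧-elim₁ : ∀ {A B} → A ∧ B ⊢ A
  ∧-elim₁ = ap (∧-elim _) (weaken (ax-K _ _))

  ∧-elim₂ : ∀ {A B} → A ∧ B ⊢ B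
  ∧-elim₂ = ap (∧-elim _) (weaken (weaken ⊢-refl))

  curry : ∀ {X A B} → X ∧ A ⊢ B → X ⊢ A ⇒ B
  curry f = ap₂ (weaken (weaken f)) pair

  nec : ∀ d {A} → Hilbert m A → Hilbert m (box d A)
  nec fwd = nec□
  nec bwd = nec■

  K-box : ∀ d {A B} → box d (A ⇒ B) ⊢ box d A ⇒ box d B
  K-box fwd = ax-K□ _ _
  K-box bwd = ax-K■ _ _

  K-dia : ∀ d {A B} → box d (A ⇒ B) ⊢ dia d A ⇒ dia d B
  K-dia fwd = ax-K◇ _ _
  K-dia bwd = ax-K◆ _ _

  box-mono : ∀ d {A B} → A ⊢ B → box d A ⊢ box d B
  box-mono d f = mp (K-box d) (nec d f)

  dia-mono : ∀ d {A B} → A ⊢ B → dia d A ⊢ dia d B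
  dia-mono d f = mp (K-dia d) (nec d f)

  -- Adjunctions between diamonds and boxes

  unit : ∀ d {A} → A ⊢ box d (dia (op d) A)
  unit fwd = ax-t2 _
  unit bwd = ax-t4 _

  unit-op : ∀ d {A} → A ⊢ box (op d) (dia d A)
  unit-op fwd = ax-t4 _
  unit-op bwd = ax-t2 _

  counit : ∀ d {A} → dia (op d) (box d A) ⊢ A
  counit fwd = ax-t1 _
  counit bwd = ax-t3 _

  counit-op : ∀ d {A} → dia d (box (op d) A) ⊢ A
  counit-op fwd = ax-t3 _
  counit-op bwd = ax-t1 _

  box→dia : ∀ d {X A} → X ⊢ box d A → dia (op d) X ⊢ A
  box→dia d f = ⊢-trans (dia-mono (op d) f) (counit d)

  dia→box : ∀ d {X A} → dia (op d) X ⊢ A → X ⊢ box d A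
  dia→box d f = ⊢-trans (unit d) (box-mono d f)

  dia-⊥ : ∀ d → dia d ⊥' ⊢ ⊥'
  dia-⊥ d = ⊢-trans (dia-mono d (⊢⊥-elim ⊢-refl)) (counit-op d)

  dia-∧ : ∀ d {X A B} → X ⊢ box d A → X ⊢ dia d B → X ⊢ dia d (B ∧ A)
  dia-∧ d f g = ap (⊢-trans (⊢-trans f (box-mono d (flip pair))) (K-dia d)) g

  dia-contra : ∀ d {X A} → X ⊢ dia d A → X ⊢ box d (¬' A) → X ⊢ ⊥'
  dia-contra d f g = ⊢-trans (ap (⊢-trans g (K-dia d)) f) (dia-⊥ d)

  -- A Fischer Servi axiom. By adjunction it suffices that `dia (op d) (dia d A ⇒ box d B) ⊢ A ⇒ B`.
  -- Since `A` yields `box (op d) (dia d A)`, the implication can be applied under `dia (op d)`, and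
  -- `counit` finishes.
  dia⇒box : ∀ d {A B} → dia d A ⇒ box d B ⊢ box d (A ⇒ B)
  dia⇒box d = dia→box d (flip (ap₂ (weaken (weaken (counit d)))
    (⊢-trans (unit-op d) (⊢-trans (box-mono (op d) (flip ⊢-refl)) (K-dia (op d))))))

  -- Currying and `dia⇒box` give `X ⊢ box d (W ⇒ C)`, so `W ⊢ W ⇒ C` by adjunction, and the two uses
  -- of `W` are contracted.
  dia-descend : ∀ d {X W C} → W ⊢ dia (op d) X → X ∧ dia d W ⊢ box d C → W ⊢ C
  dia-descend d f g = ap (⊢-trans f (box→dia d (⊢-trans (curry g) (dia⇒box d)))) ⊢-refl

  -- The canonical model

  Link : Dir → Form → Form → Set
  Link d X Y = (Y ⊢ dia (op d) X) × (X ⊢ dia d Y)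

  link-box : ∀ d {X Y A} → Link d X Y → X ⊢ box d A → Y ⊢ A
  link-box d (Y⊢ , _) f = ⊢-trans Y⊢ (box→dia d f)

  link-⊥ : ∀ d {X Y} → Link d X Y → X ⊢ ⊥' → Y ⊢ ⊥'
  link-⊥ d l f = link-box d l (⊢⊥-elim f)

  -- Keeps the target and repairs the source; by `source-⊥` the repaired source is inconsistent only
  -- if `W` is. `link-target` and `target-⊥` keep the source instead.
  link-source : ∀ d {X W} → W ⊢ dia (op d) X → Link d (X ∧ dia d W) W
  link-source d f = dia-descend d f (unit d) , ∧-elim₂

  source-⊥ : ∀ d {X W} → W ⊢ dia (op d) X → X ∧ dia d W ⊢ ⊥' → W ⊢ ⊥'
  source-⊥ d f g = dia-descend d f (⊢⊥-elim g)

  link-target : ∀ d {X Y} → X ⊢ dia d Y → Link d X (Y ∧ dia (op d) X)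
  link-target d f = ∧-elim₂ , dia-∧ d (unit d) f

  target-⊥ : ∀ d {X Y} → X ⊢ dia d Y → Y ∧ dia (op d) X ⊢ ⊥' → X ⊢ ⊥'
  target-⊥ d f g = dia-contra d f (dia→box d (flip (curry g)))

  -- Assignments and their strengthening

  Respects : RelSet → (Label → Form) → Set
  Respects R ρ = ∀ {x y} → (x , y) ∈ R → Link fwd (ρ x) (ρ y)

  respects-edge : ∀ d {R ρ v w} → Respects R ρ → edge d v w ∈ R → Link d (ρ v) (ρ w)
  respects-edge fwd r vw∈ = r vw∈
  respects-edge bwd r vw∈ = let (f , g) = r vw∈ in g , f

  respects-∷ : ∀ d {R ρ v w} → Link d (ρ v) (ρ w) → Respects R ρ → Respects (edge d v w ∷ R) ρ
  respects-∷ fwd l r (here refl)     = l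
  respects-∷ bwd (f , g) r (here refl) = g , f
  respects-∷ fwd l r (there xy∈)     = r xy∈
  respects-∷ bwd l r (there xy∈)     = r xy∈

  respects-tail : ∀ d {R ρ v w} → Respects (edge d v w ∷ R) ρ → Respects R ρ
  respects-tail d r = r ∘ there

  respects-update : ∀ {R ρ w} W → w ∉ labelsR R → Respects R ρ → Respects R (ρ [ w ↦ W ])
  respects-update {R} {ρ} {w} W w∉ r {x} {y} xy∈ with ∉-labelsR R xy∈ w∉
  ... | x≢w , y≢w rewrite update-other ρ W x≢w | update-other ρ W y≢w = r xy∈

  -- `conserve` traces an inconsistent world back to `ρ` at the same label or to `X`; the classical
  -- reading needs this, because its conclusion is an inconsistency.
  record Strengthening (R : RelSet) (ρ : Label → Form) (v : Label) (X : Form) : Set where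
    field
      world    : Label → Form
      respects : Respects R world
      stronger : ∀ x → world x ⊢ ρ x
      at       : world v ≡ X
      conserve : ∀ x → world x ⊢ ⊥' → ρ x ⊢ ⊥' ⊎ X ⊢ ⊥'

  Strengthenable : RelSet → Set
  Strengthenable R = ∀ {ρ} → Respects R ρ → ∀ v {X} → X ⊢ ρ v → Strengthening R ρ v X

  strengthenable-[] : Strengthenable []
  strengthenable-[] {ρ} r v {X} f = record
    { world = ρ [ v ↦ X ]; respects = λ (); stronger = stronger; at = update-same ρ v X
    ; conserve = conserve }
    where
    stronger : ∀ x → (ρ [ v ↦ X ]) x ⊢ ρ x
    stronger x with x ≟ v
    ... | yes refl = f
    ... | no  _    = ⊢-refl
    conserve : ∀ x → (ρ [ v ↦ X ]) x ⊢ ⊥' → ρ x ⊢ ⊥' ⊎ X ⊢ ⊥'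
    conserve x h with x ≟ v
    ... | yes _ = inj₂ h
    ... | no  _ = inj₁ h

  strengthenable-set : ∀ {R R'} → SameSet R R' → Strengthenable R → Strengthenable R'
  strengthenable-set (R⊆R' , R'⊆R) s r v f = record
    { Strengthening t; respects = Strengthening.respects t ∘ R'⊆R _ }
    where t = s (r ∘ R⊆R' _) v f

  -- `W` need not strengthen `ρ w`: for an eigenlabel `w` the old world is arbitrary.
  record Growth (d : Dir) (R : RelSet) (ρ : Label → Form) (v w : Label) (W : Form) : Set where
    field
      world    : Label → Form
      respects : Respects (edge d v w ∷ R) world
      stronger : ∀ {x} → x ≢ w → world x ⊢ ρ x
      at       : world w ≡ W
      conserve : ∀ x → world x ⊢ ⊥' → ρ x ⊢ ⊥' ⊎ W ⊢ ⊥'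

  -- First `v` is strengthened to `ρ v ∧ dia d W` within `R`; then `W` is placed at `w`, which
  -- occurs in no atom of `R`.
  grow : ∀ d {R ρ v w W} → Strengthenable R → Respects R ρ → w ≢ v → w ∉ labelsR R →
         W ⊢ dia (op d) (ρ v) → Growth d R ρ v w W
  grow d {R} {ρ} {v} {w} {W} s r w≢v w∉ f = record
    { world    = world [ w ↦ W ]
    ; respects = respects-∷ d link (respects-update W w∉ respects)
    ; stronger = λ {x} x≢w → subst (_⊢ ρ x) (sym (update-other world W x≢w)) (stronger x)
    ; at       = update-same world w W
    ; conserve = conserve'
    }
    where
    open Strengthening (s r v {ρ v ∧ dia d W} ∧-elim₁)
    link : Link d ((world [ w ↦ W ]) v) ((world [ w ↦ W ]) w)
    link rewrite update-same world w W | update-other world {w} W (w≢v ∘ sym) | at = link-source d f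
    conserve' : ∀ x → (world [ w ↦ W ]) x ⊢ ⊥' → ρ x ⊢ ⊥' ⊎ W ⊢ ⊥'
    conserve' x h with x ≟ w
    ... | yes _ = inj₂ h
    ... | no  _ = [ inj₁ , inj₂ ∘ source-⊥ d f ]′ (conserve x h)

  growth→strengthening : ∀ {d R ρ v w X} → X ⊢ ρ w → Growth d R ρ v w X →
                         Strengthening (edge d v w ∷ R) ρ w X
  growth→strengthening {ρ = ρ} {w = w} f g = record { Growth g; stronger = stronger' }
    where
    open Growth g
    stronger' : ∀ x → world x ⊢ ρ x
    stronger' x with x ≟ w
    ... | yes refl = subst (_⊢ ρ x) (sym at) f
    ... | no x≢w   = stronger x≢w

  -- A change at the leaf `w` is passed to `v` by `grow`. A change elsewhere is made within `R`
  -- first and then passed from `v` to `w`.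
  strengthenable-∷ : ∀ d {R v w} → w ≢ v → w ∉ labelsR R →
                     Strengthenable R → Strengthenable (edge d v w ∷ R)
  strengthenable-∷ d {R} {v} {w} w≢v w∉ s {ρ} r u {X} f with u ≟ w
  ... | yes refl = growth→strengthening f
    (grow d s (respects-tail d r) w≢v w∉ (⊢-trans f (proj₁ (respects-edge d r (here refl)))))
  ... | no u≢w = record
    { world    = world [ w ↦ W ]
    ; respects = respects-∷ d link (respects-update W w∉ respects)
    ; stronger = stronger'
    ; at       = trans (update-other world W u≢w) at
    ; conserve = conserve'
    }
    where
    open Strengthening (s (respects-tail d r) u f)
    W = ρ w ∧ dia (op d) (world v)
    vw = respects-edge d r (here refl)
    v⊢ : world v ⊢ dia d (ρ w)
    v⊢ = ⊢-trans (stronger v) (proj₂ vw)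
    link : Link d ((world [ w ↦ W ]) v) ((world [ w ↦ W ]) w)
    link rewrite update-same world w W | update-other world {w} W (w≢v ∘ sym) = link-target d v⊢
    stronger' : ∀ x → (world [ w ↦ W ]) x ⊢ ρ x
    stronger' x with x ≟ w
    ... | yes refl = ∧-elim₁
    ... | no  _    = stronger x
    conserve' : ∀ x → (world [ w ↦ W ]) x ⊢ ⊥' → ρ x ⊢ ⊥' ⊎ X ⊢ ⊥'
    conserve' x h with x ≟ w
    -- Inconsistency moves from the new world at `w` to `world v`, thence to `ρ v` or `X`, and from
    -- `ρ v` along the old link to `ρ w`.
    ... | yes refl = [ inj₁ ∘ link-⊥ d vw , inj₂ ]′ (conserve v (target-⊥ d v⊢ h))
    ... | no  _    = conserve x h

  -- Soundness

  -- The parameter `f` makes the monotonicity lemmas serve both forcing and refutation.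
  Holds : (Form → Form) → (Label → Form) → LForm → Set
  Holds f ρ (v , A) = ρ v ⊢ f A

  Forces Refutes : (ℕ → ℕ) → (Label → Form) → LForm → Set
  Forces θ  = Holds (rename θ)
  Refutes θ = Holds (¬' ∘ rename θ)

  Inconsistent : (Label → Form) → Set
  Inconsistent ρ = ∃[ x ] ρ x ⊢ ⊥'

  inconsistent-conserve : ∀ {ρ ρ' W} → (∀ x → ρ' x ⊢ ⊥' → ρ x ⊢ ⊥' ⊎ W ⊢ ⊥') →
                          Inconsistent ρ' → Inconsistent ρ ⊎ W ⊢ ⊥'
  inconsistent-conserve c (x , h) = Sum.map₁ (x ,_) (c x h)

  holds-mono : ∀ {f ρ ρ' Γ} → (∀ x → ρ' x ⊢ ρ x) → All (Holds f ρ) Γ → All (Holds f ρ') Γ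
  holds-mono s = All.map (⊢-trans (s _))

  holds-mono-off : ∀ {f ρ ρ' w Γ} → w ∉ map proj₁ Γ → (∀ {x} → x ≢ w → ρ' x ⊢ ρ x) →
                   All (Holds f ρ) Γ → All (Holds f ρ') Γ
  holds-mono-off w∉ s hs = All.tabulate λ x∈ → ⊢-trans (s (∉-map₁ w∉ x∈)) (All.lookup hs x∈)

  holds-cong : ∀ {f g ρ Γ} → (∀ {x} → x ∈ Γ → f (proj₂ x) ≡ g (proj₂ x)) →
               All (Holds f ρ) Γ → All (Holds g ρ) Γ
  holds-cong {ρ = ρ} eq hs = All.tabulate λ {x} x∈ →
    subst (ρ (proj₁ x) ⊢_) (eq x∈) (All.lookup hs x∈)

  rename-instance : ∀ {X} θ A C → X ⊢ rename θ (∀' A) → X ⊢ rename θ (A [ C ])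
  rename-instance {X} θ A C f = subst (X ⊢_) (sym (rename-[] θ A C)) (⊢-trans f (ax-∀E _ _))

  record FreshLabel (w v : Label) (R : RelSet) (Γ Δ : List LForm) : Set where
    field
      w≢v : w ≢ v
      w∉R : w ∉ labelsR R
      w∉Γ : w ∉ map proj₁ Γ
      w∉Δ : w ∉ map proj₁ Δ

  freshLabel : ∀ {w v} R Γ {Δ} → w ∉ v ∷ labelsSeq R Γ Δ → FreshLabel w v R Γ Δ
  freshLabel R Γ w∉ = record
    { w≢v = w∉ ∘ here
    ; w∉R = w∉ ∘ there ∘ ∈-++⁺ˡ
    ; w∉Γ = w∉ ∘ there ∘ ∈-++⁺ʳ (labelsR R) ∘ ∈-++⁺ˡ
    ; w∉Δ = w∉ ∘ there ∘ ∈-++⁺ʳ (labelsR R) ∘ ∈-++⁺ʳ (map proj₁ Γ)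
    }

  strengthenable-fresh : ∀ d {R Γ Δ v w} → FreshLabel w v R Γ Δ →
                         Strengthenable R → Strengthenable (edge d v w ∷ R)
  strengthenable-fresh d fr = strengthenable-∷ d w≢v w∉R
    where open FreshLabel fr

  -- Soundness of the intuitionistic calculus

  ValidI : RelSet → List LForm → List LForm → Set
  ValidI R Γ Δ = ∀ {θ ρ} → Respects R ρ → All (Forces θ ρ) Γ → All (Forces θ ρ) Δ

  validI-box : ∀ d {R Γ v w A} → Strengthenable R → FreshLabel w v R Γ [] →
               ValidI (edge d v w ∷ R) Γ ((w , A) ∷ []) → ValidI R Γ ((v , box d A) ∷ [])
  validI-box d {v = v} {A = A} s fr valid {θ} {ρ} r fs =
    subst (ρ v ⊢_) (sym (rename-box θ d A)) (dia→box d (subst (_⊢ rename θ A) at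
      (All.head (valid respects (holds-mono-off w∉Γ stronger fs))))) ∷ []
    where
    open FreshLabel fr
    -- The world at `w` is `dia (op d) (ρ v)`, the weakest that `grow` admits, so the premise yields
    -- exactly the adjoint form of the goal.
    open Growth (grow d s r w≢v w∉R ⊢-refl)

  soundI : ∀ {R Γ Δ} → LK intu R Γ Δ → Strengthenable R → ValidI R Γ Δ
  soundI (idr _) s r fs = fs
  soundI (cut {Γ = Γ} {Δ = []} g p q) s r fs =
    soundI q s r (All.head (soundI p s r (++⁻ˡ Γ fs)) ∷ ++⁻ʳ Γ fs)
  soundI (cut {Δ = _ ∷ _} g p q) s r fs with () ← LK-good p
  soundI (exL _ π p) s r fs = soundI p s r (All-resp-↭ (↭-sym π) fs)
  soundI (exR _ π p) s r fs = All-resp-↭ π (soundI p s r fs)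
  soundI (setR _ e p) s r fs =
    soundI p (strengthenable-set (proj₂ e , proj₁ e) s) (r ∘ proj₁ e _) fs
  soundI (wL _ p) s r (_ ∷ fs) = soundI p s r fs
  soundI (wR {Δ = []} _ p) s r fs with () ← LK-good p
  soundI (cL _ p) s r (f ∷ fs) = soundI p s r (f ∷ f ∷ fs)
  soundI (cR _ p) s r fs = All.tail (soundI p s r fs)
  soundI (⇒L {Γ = Γ} {Δ = []} g p q) s r (f ∷ fs) =
    soundI q s r (ap f (All.head (soundI p s r (++⁻ˡ Γ fs))) ∷ ++⁻ʳ Γ fs)
  soundI (⇒L {Δ = _ ∷ _} g p q) s r fs with () ← LK-good p
  soundI (⇒R {Δ = []} {v = v} {A = A} {B = B} _ p) s {θ} r fs =
    curry (subst (_⊢ rename θ B) at (All.head (soundI p s respects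
      (subst (_⊢ rename θ A) (sym at) ∧-elim₂ ∷ holds-mono stronger fs)))) ∷ []
    -- The new world at `v` is `ρ v ∧ rename θ A`.
    where open Strengthening (s r v ∧-elim₁)
  soundI (∀L {A = A} C _ p) s {θ} r (f ∷ fs) = soundI p s r (rename-instance θ A C f ∷ fs)
  soundI (∀R {Γ = Γ} {Δ = []} {v = v} {A = A} P _ P∉ p) s {θ} {ρ} r fs =
    -- The premise is read under `θ [ P ↦ Q ]`, with `Q` the atom picked by `∀-intro`. As `P` is
    -- absent from the conclusion, `Γ` and `A` are unaffected.
    ∀-intro (ρ v) _ (subst (ρ v ⊢_) (rename-update-[] θ _ A (∉-atomsSeq Γ _ (∈-++⁺ʳ Γ (here refl)) P∉))
      (All.head (soundI p s r (holds-cong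
        (λ x∈ → sym (rename-update θ _ _ (∉-atomsSeq Γ _ (∈-++⁺ˡ x∈) P∉))) fs)))) ∷ []
  soundI (□L _ vw∈ p) s r (f ∷ fs) = soundI p s r (link-box fwd (respects-edge fwd r vw∈) f ∷ fs)
  soundI (■L _ uv∈ p) s r (f ∷ fs) = soundI p s r (link-box bwd (respects-edge bwd r uv∈) f ∷ fs)
  soundI (□R {R} {Γ} {[]} w _ w∉ p) s =
    validI-box fwd s fr (soundI p (strengthenable-fresh fwd fr s))
    where fr = freshLabel R Γ w∉
  soundI (■R {R} {Γ} {[]} u _ u∉ p) s =
    validI-box bwd s fr (soundI p (strengthenable-fresh bwd fr s))
    where fr = freshLabel R Γ u∉

  -- Soundness of the classical calculus

  ValidC : RelSet → List LForm → List LForm → Set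
  ValidC R Γ Δ = ∀ {θ ρ} → Respects R ρ → All (Forces θ ρ) Γ → All (Refutes θ ρ) Δ → Inconsistent ρ

  module _ (dne : ∀ {A} → Hilbert m (¬' (¬' A) ⇒ A)) where

    refute-⇒₁ : ∀ {X A B} → X ⊢ ¬' (A ⇒ B) → X ⊢ A
    refute-⇒₁ f = ⊢-trans (ap₂ (⊢-trans f (ax-K _ _)) (weaken (ap₂ (weaken (weaken (ax-∀E _ _))) ⊢-refl))) dne

    refute-⇒₂ : ∀ {X A B} → X ⊢ ¬' (A ⇒ B) → X ⊢ ¬' B
    refute-⇒₂ f = ap₂ (⊢-trans f (ax-K _ _)) (weaken (ax-K _ _))

    -- Conjoining the negation of `A` to `ρ v` meets the hypotheses of the sequent. The resulting
    -- inconsistency lies in `ρ` already or refutes the conjunction, and then `dne` applies.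
    by-contradiction : ∀ {R Γ Δ v A θ ρ} → Strengthenable R → ValidC R Γ ((v , A) ∷ Δ) →
      Respects R ρ → All (Forces θ ρ) Γ → All (Refutes θ ρ) Δ → Inconsistent ρ ⊎ ρ v ⊢ rename θ A
    by-contradiction {v = v} {A = A} {θ = θ} s valid r fs ns =
      Sum.map₂ (λ h → ⊢-trans (curry h) dne)
      (inconsistent-conserve conserve (valid respects (holds-mono stronger fs)
        (subst (_⊢ ¬' (rename θ A)) (sym at) ∧-elim₂ ∷ holds-mono stronger ns)))
      where open Strengthening (s r v ∧-elim₁)

    validC-box : ∀ d {R Γ Δ v w A} → Strengthenable R → FreshLabel w v R Γ Δ →
                 ValidC (edge d v w ∷ R) Γ ((w , A) ∷ Δ) → ValidC R Γ ((v , box d A) ∷ Δ)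
    validC-box d {v = v} {A = A} s fr valid {θ} {ρ} r fs (n ∷ ns) =
      [ id , (λ h → v , ap n (subst (ρ v ⊢_) (sym (rename-box θ d A))
                                (dia→box d (⊢-trans (curry h) dne)))) ]′
      (inconsistent-conserve conserve (valid respects (holds-mono-off w∉Γ stronger fs)
        (subst (_⊢ ¬' (rename θ A)) (sym at) ∧-elim₂ ∷ holds-mono-off w∉Δ stronger ns)))
      where
      open FreshLabel fr
      -- The world at `w` is `dia (op d) (ρ v) ∧ ¬' (rename θ A)`; if it is inconsistent, `dne` and
      -- adjunction contradict `n` at `v`.
      open Growth (grow d s r w≢v w∉R ∧-elim₁)

    soundC : ∀ {R Γ Δ} → LK clas R Γ Δ → Strengthenable R → ValidC R Γ Δ
    soundC (idr {v = v} _) s r (f ∷ []) (n ∷ []) = v , ap n f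
    soundC (cut {Γ = Γ} {Δ = Δ} _ p q) s r fs ns =
      [ id , (λ f → soundC q s r (f ∷ ++⁻ʳ Γ fs) (++⁻ʳ Δ ns)) ]′
      (by-contradiction s (soundC p s) r (++⁻ˡ Γ fs) (++⁻ˡ Δ ns))
    soundC (exL _ π p) s r fs ns = soundC p s r (All-resp-↭ (↭-sym π) fs) ns
    soundC (exR _ π p) s r fs ns = soundC p s r fs (All-resp-↭ (↭-sym π) ns)
    soundC (setR _ e p) s r fs ns =
      soundC p (strengthenable-set (proj₂ e , proj₁ e) s) (r ∘ proj₁ e _) fs ns
    soundC (wL _ p) s r (_ ∷ fs) ns = soundC p s r fs ns
    soundC (wR _ p) s r fs (_ ∷ ns) = soundC p s r fs ns
    soundC (cL _ p) s r (f ∷ fs) ns = soundC p s r (f ∷ f ∷ fs) ns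
    soundC (cR _ p) s r fs (n ∷ ns) = soundC p s r fs (n ∷ n ∷ ns)
    soundC (⇒L {Γ = Γ} {Δ = Δ} _ p q) s r (f ∷ fs) ns =
      [ id , (λ a → soundC q s r (ap f a ∷ ++⁻ʳ Γ fs) (++⁻ʳ Δ ns)) ]′
      (by-contradiction s (soundC p s) r (++⁻ˡ Γ fs) (++⁻ˡ Δ ns))
    soundC (⇒R _ p) s r fs (n ∷ ns) = soundC p s r (refute-⇒₁ n ∷ fs) (refute-⇒₂ n ∷ ns)
    soundC (∀L {A = A} C _ p) s {θ} r (f ∷ fs) ns = soundC p s r (rename-instance θ A C f ∷ fs) ns
    soundC (∀R {Γ = Γ} {Δ} {v} {A} P _ P∉ p) s {θ} {ρ} r fs (n ∷ ns) =
      [ id , (λ f → v , ap n (∀-intro (ρ v) _ (subst (ρ v ⊢_) (rename-update-[] θ _ A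
                                                     (∉-atomsSeq Γ _ (∈-++⁺ʳ Γ (here refl)) P∉)) f))) ]′
      (by-contradiction s (soundC p s) r
        (holds-cong (λ x∈ → sym (rename-update θ _ _ (∉-atomsSeq Γ _ (∈-++⁺ˡ x∈) P∉))) fs)
        (holds-cong (λ x∈ → cong ¬' (sym (rename-update θ _ _
                                            (∉-atomsSeq Γ _ (∈-++⁺ʳ Γ (there x∈)) P∉)))) ns))
    soundC (□L _ vw∈ p) s r (f ∷ fs) ns = soundC p s r (link-box fwd (respects-edge fwd r vw∈) f ∷ fs) ns
    soundC (■L _ uv∈ p) s r (f ∷ fs) ns = soundC p s r (link-box bwd (respects-edge bwd r uv∈) f ∷ fs) ns
    soundC (□R {R} {Γ} w _ w∉ p) s =
      validC-box fwd s fr (soundC p (strengthenable-fresh fwd fr s))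
      where fr = freshLabel R Γ w∉
    soundC (■R {R} {Γ} u _ u∉ p) s =
      validC-box bwd s fr (soundC p (strengthenable-fresh bwd fr s))
      where fr = freshLabel R Γ u∉

    ℓKt2⇒Hilbert : ∀ {v A} → ℓKt2⊢ v A → Hilbert m A
    ℓKt2⇒Hilbert {v} {A} p = mp dne (subst (λ B → Hilbert m (¬' (¬' B))) (rename-id A)
      -- With `¬' A` at every label `A` is refuted, so whichever world is inconsistent proves
      -- `¬' (¬' A)`.
      (proj₂ (soundC p strengthenable-[] {id} {λ _ → ¬' (rename id A)} (λ ()) [] (⊢-refl ∷ []))))

  ℓIKt2⇒Hilbert : ∀ {v A} → ℓIKt2⊢ v A → Hilbert m A
  ℓIKt2⇒Hilbert {v} {A} p = subst (Hilbert m) (rename-id A)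
    -- The theorem `⊥' ⇒ ⊥'` serves as world, so it can be discharged.
    (mp (All.head (soundI p strengthenable-[] {id} {λ _ → ⊥' ⇒ ⊥'} (λ ()) [])) ⊢-refl)

theorem7p1 : (∀ (v : Label) (A : Form) → ℓIKt2⊢ v A → IKt2⊢ A)
    × (∀ (v : Label) (A : Form) → ℓKt2⊢ v A → Kt2⊢ A)
theorem7p1 = (λ _ _ → ℓIKt2⇒Hilbert) , (λ _ _ → ℓKt2⇒Hilbert (ax-dne refl _))
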